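{- Let $\omega=\{0,1,2,\dots\}$ and define a metric $\rho'$ on $\omega$ by $\rho'(n,n)=0$ and $\rho'(n,m)=\max\{n,m\}$ for $n\neq m$. Define a metric $\rho$ on $\omega\times\omega$ by $\rho((n,m),(n',m'))=\max\{\rho'(n,n'),\rho'(m,m')\}$, and let $W_2$ be the subspace $$W_2=\{(n,0):n\in\omega\}\cup\{(n,m):n>m>0\}$$ of $(\omega\times\omega,\rho)$. Let $(X,d)$ be a metric space (with integer valued metric). Then $(X,d)$ is asymptotically scattered if and only if no subspace of $(X,d)$ is asymorphic to $W_2$.
   Context: All metrics are supposed to take values in $\omega=\{0,1,2,\dots\}$. For a metric space $(X,d)$, $x\in X$, $m\in\omega$, put $B(x,m)=\{y\in X:d(x,y)\le m\}$. A subset $V\subseteq X$ is bounded if $V\subseteq B(x_0,n)$ for some $x_0\in X$, $n\in\omega$. A subset $Y\subseteq X$ has asymptotically isolated balls (in $X$) if there exist $m\in\omega$, a sequence $(y_n)_{n\in\omega}$ in $Y$ and a strictly increasing sequence $(m_n)_{n\in\omega}$ in $\omega$ with $m_0>m$ such that $B(y_n,m_n)\setminus B(y_n,m)=\varnothing$ for each $n\in\omega$ (the balls are taken in $X$). The metric space $(X,d)$ is asymptotically scattered if each unbounded subset of $X$ has asymptotically isolated balls. For metric spaces $(X_1,d_1)$, $(X_2,d_2)$, a bijection $f:X_1\to X_2$ is an asymorphism if there are sequences $(c_n)_{n\in\omega}$, $(c_n')_{n\in\omega}$ in $\omega$ such that for all $n\in\omega$ and $x,y\in X_1$: $d_1(x,y)\le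 n\Rightarrow d_2(f(x),f(y))<c_n$, and $d_2(f(x),f(y))\le n\Rightarrow d_1(x,y)<c_n'$. Two spaces are asymorphic if there is an asymorphism between them. A subspace is a subset with the restricted metric. -}

module Defs where

open import Data.Empty using (⊥-elim)
open import Data.Nat.Base using (ℕ; _+_; _⊔_; _≤_; _<_; z≤n)
open import Data.Nat.Properties
open import Data.Product.Base using (Σ; ∃-syntax; Σ-syntax; _×_; _,_; proj₁)
open import Function.Bundles using (Bijection)
open import Function.Metric.Nat using (Metric)
open import Level using (Level; 0ℓ)
  renaming (_⊔_ to _⊔ˡ_; suc to sucˡ)
open import Relation.Binary.Bundles using (Setoid)
open import Relation.Binary.Definitions using (Monotonic₁; _Respects_)
open import Relation.Binary.PropositionalEquality.Core
  using (_≡_; refl; sym; trans; cong₂)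
import Relation.Binary.PropositionalEquality.Properties as ≡
open import Relation.Nullary using (¬_; yes; no)
open import Relation.Unary using (Pred; _∈_; _⊆_; _∪_; _∖_; Empty)

private
  variable
    a b ℓ ℓ₁ ℓ₂ p : Level

setoid : Metric a ℓ → Setoid a ℓ
setoid X = record { isEquivalence = Metric.≈-isEquivalence X }

module _ (X : Metric a ℓ) where
  open Metric X using (Carrier; _≈_; d)

  B : Carrier → ℕ → Pred Carrier 0ℓ
  B x m y = d x y ≤ m

  -- The empty subset of the empty space is not bounded in this sense, since
  -- there is no centre.
  Bounded : Pred Carrier p → Set (a ⊔ˡ p)
  Bounded V = ∃[ x₀ ] ∃[ n ] V ⊆ B x₀ n

  -- The balls are taken in X, not in Y.
  HasAsymptoticallyIsolatedBalls : Pred Carrier p → Set (a ⊔ˡ p)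
  HasAsymptoticallyIsolatedBalls Y =
    ∃[ m ] Σ[ y ∈ (ℕ → Carrier) ] Σ[ r ∈ (ℕ → ℕ) ]
      (∀ n → y n ∈ Y) ×
      Monotonic₁ _<_ _<_ r ×
      m < r 0 ×
      (∀ n → Empty (B (y n) (r n) ∖ B (y n) m))

  -- Equality of points is the setoid equality _≈_, so a subset is a predicate
  -- respecting it.
  AsymptoticallyScattered : ∀ p → Set (a ⊔ˡ ℓ ⊔ˡ sucˡ p)
  AsymptoticallyScattered p =
    (Y : Pred Carrier p) → Y Respects _≈_ →
    ¬ Bounded Y → HasAsymptoticallyIsolatedBalls Y

-- Points of a subspace are compared by their first components only, so
-- different membership proofs do not give different points.
Subspace : (X : Metric a ℓ) → Pred (Metric.Carrier X) p → Metric (a ⊔ˡ p) ℓ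
Subspace X S = record
  { Carrier  = Σ Carrier S
  ; _≈_      = λ u v → proj₁ u ≈ proj₁ v
  ; d        = λ u v → d (proj₁ u) (proj₁ v)
  ; isMetric = record
    { isSemiMetric = record
      { isQuasiSemiMetric = record
        { isPreMetric = record
          { isProtoMetric = record
            { isPartialOrder  = X.isPartialOrder
            ; ≈-isEquivalence = record
              { refl  = X.EqC.refl
              ; sym   = X.EqC.sym
              ; trans = X.EqC.trans
              }
            ; cong            = X.cong
            ; nonNegative     = z≤n
            }
          ; ≈⇒0 = X.≈⇒0
          }
        ; 0⇒≈ = X.0⇒≈
        }
      ; sym = λ u v → X.sym (proj₁ u) (proj₁ v)
      }
    ; triangle = λ u v w → X.triangle (proj₁ u) (proj₁ v) (proj₁ w)
    }
  }
  where
  module X = Metric X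
  open X using (Carrier; _≈_; d)

record Asymorphism (X₁ : Metric a ℓ₁) (X₂ : Metric b ℓ₂)
                   : Set (a ⊔ˡ b ⊔ˡ ℓ₁ ⊔ˡ ℓ₂) where
  private
    module X₁ = Metric X₁
    module X₂ = Metric X₂
  field
    bijection : Bijection (setoid X₁) (setoid X₂)
  open Bijection bijection public using () renaming (to to f)
  field
    c c′      : ℕ → ℕ
    f-control : ∀ n x y → X₁.d x y ≤ n → X₂.d (f x) (f y) < c n
    f-reflect : ∀ n x y → X₂.d (f x) (f y) ≤ n → X₁.d x y < c′ n

HasSubspaceAsymorphicTo : (X : Metric a ℓ₁) → Metric b ℓ₂ → ∀ p →
                          Set (a ⊔ˡ b ⊔ˡ ℓ₁ ⊔ˡ ℓ₂ ⊔ˡ sucˡ p)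
HasSubspaceAsymorphicTo X Z p =
  Σ[ S ∈ Pred Carrier p ] S Respects _≈_ × Asymorphism (Subspace X S) Z
  where open Metric X using (Carrier; _≈_)

ρ′ : ℕ → ℕ → ℕ
ρ′ n m with n ≟ m
... | yes _ = 0
... | no  _ = n ⊔ m

ρ : ℕ × ℕ → ℕ × ℕ → ℕ
ρ (n , m) (n′ , m′) = ρ′ n n′ ⊔ ρ′ m m′

private
  ρ′-refl : ∀ n → ρ′ n n ≡ 0
  ρ′-refl n with n ≟ n
  ... | yes _   = refl
  ... | no  n≢n = ⊥-elim (n≢n refl)

  ρ′-0⇒≡ : ∀ n m → ρ′ n m ≡ 0 → n ≡ m
  ρ′-0⇒≡ n m eq with n ≟ m
  ... | yes n≡m = n≡m
  ... | no  _   = trans (n≤0⇒n≡0 (m⊔n≤o⇒m≤o n m (≤-reflexive eq)))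
                        (sym (n≤0⇒n≡0 (m⊔n≤o⇒n≤o n m (≤-reflexive eq))))

  ρ′-sym : ∀ n m → ρ′ n m ≡ ρ′ m n
  ρ′-sym n m with n ≟ m | m ≟ n
  ... | yes _   | yes _   = refl
  ... | yes n≡m | no  m≢n = ⊥-elim (m≢n (sym n≡m))
  ... | no  n≢m | yes m≡n = ⊥-elim (n≢m (sym m≡n))
  ... | no  _   | no  _   = ⊔-comm n m

  ρ′-triangle : ∀ i j k → ρ′ i k ≤ ρ′ i j + ρ′ j k
  ρ′-triangle i j k with i ≟ k | i ≟ j | j ≟ k
  ... | yes _   | _        | _        = z≤n
  ... | no  i≢k | yes refl | yes refl = ⊥-elim (i≢k refl)
  ... | no  _   | yes refl | no  _    = ≤-refl
  ... | no  _   | no  _    | yes refl = m≤m+n (i ⊔ j) 0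
  ... | no  _   | no  _    | no  _    =
    ⊔-lub (≤-trans (m≤m⊔n i j) (m≤m+n (i ⊔ j) (j ⊔ k)))
          (≤-trans (m≤n⊔m j k) (m≤n+m (j ⊔ k) (i ⊔ j)))

  ρ-0⇒≡ : ∀ u v → ρ u v ≡ 0 → u ≡ v
  ρ-0⇒≡ (n , m) (n′ , m′) eq = cong₂ _,_
    (ρ′-0⇒≡ n n′ (n≤0⇒n≡0 (m⊔n≤o⇒m≤o (ρ′ n n′) (ρ′ m m′) (≤-reflexive eq))))
    (ρ′-0⇒≡ m m′ (n≤0⇒n≡0 (m⊔n≤o⇒n≤o (ρ′ n n′) (ρ′ m m′) (≤-reflexive eq))))

  ρ-triangle : ∀ u v w → ρ u w ≤ ρ u v + ρ v w
  ρ-triangle (n , m) (n′ , m′) (n″ , m″) = ⊔-lub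
    (≤-trans (ρ′-triangle n n′ n″)
      (+-mono-≤ (m≤m⊔n (ρ′ n n′) (ρ′ m m′)) (m≤m⊔n (ρ′ n′ n″) (ρ′ m′ m″))))
    (≤-trans (ρ′-triangle m m′ m″)
      (+-mono-≤ (m≤n⊔m (ρ′ n n′) (ρ′ m m′)) (m≤n⊔m (ρ′ n′ n″) (ρ′ m′ m″))))

ω×ω : Metric 0ℓ 0ℓ
ω×ω = record
  { Carrier  = ℕ × ℕ
  ; _≈_      = _≡_
  ; d        = ρ
  ; isMetric = record
    { isSemiMetric = record
      { isQuasiSemiMetric = record
        { isPreMetric = record
          { isProtoMetric = record
            { isPartialOrder  = ≤-isPartialOrder
            ; ≈-isEquivalence = ≡.isEquivalence
            ; cong            = cong₂ ρ
            ; nonNegative     = z≤n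
            }
          ; ≈⇒0 = λ { {n , m} refl → cong₂ _⊔_ (ρ′-refl n) (ρ′-refl m) }
          }
        ; 0⇒≈ = λ {u} {v} → ρ-0⇒≡ u v
        }
      ; sym = λ { (n , m) (n′ , m′) → cong₂ _⊔_ (ρ′-sym n n′) (ρ′-sym m m′) }
      }
    ; triangle = ρ-triangle
    }
  }

W₂ : Metric 0ℓ 0ℓ
W₂ = Subspace ω×ω ((λ (_ , m) → m ≡ 0) ∪ (λ (n , m) → m < n × 0 < m))

{-# OPTIONS --safe #-}
module Submission where

open import Defs
open import Axiom.DoubleNegationElimination
  using (DoubleNegationElimination; em⇒dne)
open import Axiom.ExcludedMiddle using (ExcludedMiddle)
open import Data.Nat.Base using (ℕ; zero; suc; _+_; _≤_; _<_; z≤n; s≤s; z<s; s≤s⁻¹)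
  renaming (_⊔_ to _⊔ⁿ_)
open import Data.Nat.Properties
open import Data.Product.Base
  using (Σ; Σ-syntax; ∃-syntax; _×_; _,_; proj₁; proj₂)
open import Data.Sum.Base using (inj₁; inj₂)
open import Function.Base using (_∘_)
open import Function.Bundles using (Bijection; _⇔_; mk⇔)
open import Function.Metric.Nat using (Metric)
open import Level using (Level; Lift; lift; lower; _⊔_)
open import Relation.Binary.Definitions
  using (tri<; tri≈; tri>; Monotonic₁; _Respects_)
open import Relation.Binary.PropositionalEquality
  using (_≡_; refl; sym; trans; cong; cong₂; subst; subst₂)
open import Relation.Nullary using (¬_; yes; no; contradiction)
open import Relation.Unary using (Pred; _∈_; _∖_; Empty)

-- (⇒) If f maps a subspace of X onto W₂, the preimage Y of the axis
-- {(n , 0)} is unbounded, and (n , 0) has points of W₂ at every prescribed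
-- distance j > 0 (up to 1).  Pulled back along f, these points meet all the
-- annuli B(y,r) ∖ B(y,m), y ∈ Y, with r large in terms of m only.
--
-- (⇐) If an unbounded Y has no asymptotically isolated balls, every m admits
-- an N such that m < d(y,z) ≤ N has a solution z for every y ∈ Y.  Iterating
-- m ↦ N(2m) gives each y ∈ Y satellites z₁, z₂, … at rapidly increasing
-- distances that are bounded uniformly in y.  For a sparse sequence
-- y₀, y₁, … in Y, the map sending (n , 0) to yₙ and (n , j) to the j-th
-- satellite of yₙ does not decrease distances, and it is coarsely Lipschitz.
-- The choices of N, z and yₙ cost nothing: excluded middle for all types, in
-- particular for Σ-types, produces witnesses.

private
  variable
    a b ℓ ℓ₂ p q : Level

-- Double negation and monotone sequences.

dne-lower : DoubleNegationElimination (p ⊔ q) → DoubleNegationElimination p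
dne-lower {q = q} dne ¬¬P =
  lower (dne {Lift q _} λ ¬P → ¬¬P λ x → ¬P (lift x))

nondecreasing⇒monotonic : {f : ℕ → ℕ} → (∀ n → f n ≤ f (suc n)) →
                          Monotonic₁ _≤_ _≤_ f
nondecreasing⇒monotonic {f} step {m} {n} m≤n = go n m≤n
  where
  go : ∀ n → m ≤ n → f m ≤ f n
  go n m≤n with m≤n⇒m<n∨m≡n m≤n
  go n       _ | inj₂ refl = ≤-refl
  go (suc n) _ | inj₁ m<n  = ≤-trans (go n (s≤s⁻¹ m<n)) (step n)

increasing⇒n≤f[n] : {f : ℕ → ℕ} → (∀ n → f n < f (suc n)) → ∀ n → n ≤ f n
increasing⇒n≤f[n] step zero    = z≤n
increasing⇒n≤f[n] step (suc n) =
  ≤-<-trans (increasing⇒n≤f[n] step n) (step n)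

-- Distances in `W₂`.

ρ′-refl : ∀ n → ρ′ n n ≡ 0
ρ′-refl n rewrite ≟-diag (refl {x = n}) = refl

ρ′-< : ∀ {m n} → m < n → ρ′ m n ≡ n
ρ′-< {m} {n} m<n with m ≟ n
... | yes m≡n = contradiction m≡n (<⇒≢ m<n)
... | no  _   = m≤n⇒m⊔n≡n (<⇒≤ m<n)

ρ′≤⊔ : ∀ m n → ρ′ m n ≤ m ⊔ⁿ n
ρ′≤⊔ m n with m ≟ n
... | yes _ = z≤n
... | no  _ = ≤-refl

ρ-sameColumn : ∀ n {i j} → i < j → ρ (n , i) (n , j) ≡ j
ρ-sameColumn n i<j rewrite ρ′-refl n = ρ′-< i<j

-- Both heights are at most the larger column index, which therefore dominates the maximum.
ρ-differentColumns : ∀ {m n i j} → m < n → i ≤ m → j ≤ n →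
                     ρ (m , i) (n , j) ≡ n
ρ-differentColumns {i = i} {j} m<n i≤m j≤n rewrite ρ′-< m<n =
  m≥n⇒m⊔n≡m (≤-trans (ρ′≤⊔ i j) (⊔-lub (≤-trans i≤m (<⇒≤ m<n)) j≤n))

W₂-below : (w : Metric.Carrier W₂) → proj₂ (proj₁ w) ≤ proj₁ (proj₁ w)
W₂-below (_ , inj₁ refl)      = z≤n
W₂-below (_ , inj₂ (m<n , _)) = <⇒≤ m<n

axis : ℕ → Metric.Carrier W₂
axis n = (n , 0) , inj₁ refl

-- For `j < n` the column over `n` has a point of height `j`. Otherwise the column is too short, and
-- the axis point over `suc j` replaces it at the cost of one.
W₂-nearby : ∀ n j → 0 < j →
            Σ[ (w , _) ∈ Metric.Carrier W₂ ]
              (j ≤ ρ (n , 0) w × ρ (n , 0) w ≤ suc j)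
W₂-nearby n j 0<j with j <? n
... | yes j<n = ((n , j) , inj₂ (j<n , 0<j)) ,
                ≤-reflexive (sym (ρ-sameColumn n 0<j)) ,
                ≤-trans (≤-reflexive (ρ-sameColumn n 0<j)) (n≤1+n j)
... | no  j≮n = axis (suc j) ,
                ≤-trans (n≤1+n j) (≤-reflexive (sym ρ≡1+j)) ,
                ≤-reflexive ρ≡1+j
  where
  ρ≡1+j : ρ (n , 0) (suc j , 0) ≡ suc j
  ρ≡1+j = ρ-differentColumns (s≤s (≮⇒≥ j≮n)) z≤n z≤n

-- Asymorphic copies from expanding maps.

module _ (X : Metric a ℓ) where
  open Metric X using (Carrier; _≈_; d; module EqC; ≈⇒0; 0⇒≈; triangle)
    renaming (sym to d-sym; cong to d-cong)

  -- The image of the embedding g is cut out by "at distance 0 from some g z",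
  -- which keeps the level ℓ of _≈_ out of the level of the subset.
  expandingEmbedding : ∀ p (Z : Metric b ℓ₂) (let module Z = Metric Z)
    (g : Z.Carrier → Carrier) → (∀ {u v} → u Z.≈ v → g u ≈ g v) →
    (∀ u v → Z.d u v ≤ d (g u) (g v)) →
    (U : ℕ → ℕ) → (∀ n u v → Z.d u v ≤ n → d (g u) (g v) ≤ U n) →
    HasSubspaceAsymorphicTo X Z (b ⊔ p)
  expandingEmbedding p Z g g-cong expand U coarse = Image , Image-resp , record
    { bijection = record
      { to        = index
      ; cong      = λ {s} {t} s≈t → g-reflects
          (EqC.trans (at s) (EqC.trans s≈t (EqC.sym (at t))))
      ; bijective =
          (λ {s} {t} e → EqC.trans (EqC.sym (at s)) (EqC.trans (g-cong e) (at t))) ,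
          λ u → (g u , lift (u , ≈⇒0 EqC.refl)) , λ {s} s≈gu →
            g-reflects (EqC.trans (at s) s≈gu)
      }
    ; c         = suc
    ; c′        = suc ∘ U
    ; f-control = λ n s t d≤n → s≤s
        (≤-trans (expand (index s) (index t)) (≤-trans (≤-reflexive (d-at s t)) d≤n))
    ; f-reflect = λ n s t ρ≤n → s≤s
        (≤-trans (≤-reflexive (sym (d-at s t))) (coarse n (index s) (index t) ρ≤n))
    }
    where
    module Z = Metric Z

    g-reflects : ∀ {u v} → g u ≈ g v → u Z.≈ v
    g-reflects {u} {v} gu≈gv = Z.0⇒≈ (n≤0⇒n≡0
      (≤-trans (expand u v) (≤-reflexive (≈⇒0 gu≈gv))))

    Image : Pred Carrier _
    Image x = Lift p (Σ[ u ∈ Z.Carrier ] d (g u) x ≡ 0)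

    Image-resp : Image Respects _≈_
    Image-resp x≈y (lift (u , e)) = lift (u , ≈⇒0 (EqC.trans (0⇒≈ e) x≈y))

    index : Σ Carrier Image → Z.Carrier
    index (_ , lift (u , _)) = u

    at : ∀ s → g (index s) ≈ proj₁ s
    at (_ , lift (_ , e)) = 0⇒≈ e

    d-at : ∀ s t → d (g (index s)) (g (index t)) ≡ d (proj₁ s) (proj₁ t)
    d-at s t = d-cong (at s) (at t)

  -- Scattered spaces contain no copy of `W₂`.

  scattered⇒¬asymorphic : AsymptoticallyScattered X p →
                          ¬ HasSubspaceAsymorphicTo X W₂ p
  scattered⇒¬asymorphic {p = p} scattered (S , S-resp , A) =
    noIsolatedBalls (scattered Y Y-resp Y-unbounded)
    where
    open Asymorphism A renaming (bijection to β)

    f-cong : ∀ {s t} → proj₁ s ≈ proj₁ t → proj₁ (f s) ≡ proj₁ (f t)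
    f-cong = Bijection.cong β

    preimage : ∀ w → Σ[ s ∈ Σ Carrier S ] proj₁ (f s) ≡ proj₁ w
    preimage = Bijection.strictlySurjective β

    Y : Pred Carrier p
    Y x = Σ[ s ∈ S x ] proj₂ (proj₁ (f (x , s))) ≡ 0

    Y-resp : Y Respects _≈_
    Y-resp x≈y (s , e) = S-resp x≈y s , trans (cong proj₂ (f-cong (EqC.sym x≈y))) e

    Y-unbounded : ¬ Bounded X Y
    Y-unbounded (x₀ , n , Y⊆B) = <-irrefl refl (begin-strict
      k
        ≤⟨ n≤1+n k ⟩
      suc k
        ≡⟨ ρ-differentColumns z<s z≤n z≤n ⟨
      ρ (0 , 0) (suc k , 0)
        ≡⟨ cong₂ ρ (proj₂ s) (proj₂ t) ⟨
      ρ (proj₁ (f (proj₁ s))) (proj₁ (f (proj₁ t)))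
        <⟨ f-control (n + n) (proj₁ s) (proj₁ t) d≤ ⟩
      k ∎)
      where
      open ≤-Reasoning
      -- Points within `n` of `x₀` are at most `n + n` apart, so their images are less than `k`
      -- apart; two axis points at distance `suc k` contradict this.
      k : ℕ
      k = c (n + n)
      s = preimage (axis 0)
      t = preimage (axis (suc k))
      near : ∀ {m} (u : Σ[ u ∈ Σ Carrier S ] proj₁ (f u) ≡ (m , 0)) →
             d x₀ (proj₁ (proj₁ u)) ≤ n
      near ((_ , s) , e) = Y⊆B (s , cong proj₂ e)
      d≤ : d (proj₁ (proj₁ s)) (proj₁ (proj₁ t)) ≤ n + n
      d≤ = ≤-trans (triangle _ x₀ _)
        (+-mono-≤ (≤-trans (≤-reflexive (d-sym _ x₀)) (near s)) (near t))

    noIsolatedBalls : ¬ HasAsymptoticallyIsolatedBalls X Y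
    noIsolatedBalls (m , y , r , y∈Y , r-mono , _ , isolated) =
      isolated K x (x∈ball , x∉ball)
      where
      -- Image distance at least `j` exceeds `c m` and so forces distance above `m`. Image distance
      -- at most `suc j` forces distance below `K`, and `K ≤ r K`, so `K` also serves as the index
      -- of the ball.
      j = suc (c m)
      K = c′ (suc j)
      s : Σ Carrier S
      s = y K , proj₁ (y∈Y K)
      nearby = W₂-nearby (proj₁ (proj₁ (f s))) j z<s
      w = proj₁ nearby
      t = proj₁ (preimage w)
      x = proj₁ t
      ρ≡ : ρ (proj₁ (f s)) (proj₁ (f t)) ≡ ρ (proj₁ (proj₁ (f s)) , 0) (proj₁ w)
      ρ≡ = cong₂ ρ (cong (proj₁ (proj₁ (f s)) ,_) (proj₂ (y∈Y K))) (proj₂ (preimage w))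
      x∈ball : d (y K) x ≤ r K
      x∈ball = ≤-trans
        (<⇒≤ (f-reflect (suc j) s t (≤-trans (≤-reflexive ρ≡) (proj₂ (proj₂ nearby)))))
        (increasing⇒n≤f[n] (λ n → r-mono (n<1+n n)) K)
      x∉ball : ¬ d (y K) x ≤ m
      x∉ball d≤m = <-asym (f-control m s t d≤m)
        (≤-trans (proj₁ (proj₂ nearby)) (≤-reflexive (sym ρ≡)))

  -- Unbounded sets without isolated balls.

  FilledAnnuli : Pred Carrier p → Set _
  FilledAnnuli Y =
    ∀ m → ∃[ N ] (∀ y → y ∈ Y → ∃[ z ] m < d y z × d y z ≤ N)

  Far : Carrier → Pred Carrier p → Set _
  Far x₀ Y = ∀ n → Σ[ (y , _) ∈ Σ Carrier Y ] n < d x₀ y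

  module _ {Y : Pred Carrier p} (dne : DoubleNegationElimination (a ⊔ p)) where

    -- If no `N` served for `m`, each `N` would have a centre in `Y` with empty annulus. Centres for
    -- the radii `suc m + n` would then give isolated balls.
    ¬isolated⇒filledAnnuli : ¬ HasAsymptoticallyIsolatedBalls X Y → FilledAnnuli Y
    ¬isolated⇒filledAnnuli ¬isolated m = dne λ ¬N →
      let gap : ∀ N → Σ[ y ∈ Carrier ] y ∈ Y × Empty (B X y N ∖ B X y m)
          gap N = dne λ ¬gap → ¬N (N , λ y y∈Y → dne-lower {q = p} dne λ ¬z →
            ¬gap (y , y∈Y , λ z (z∈ , z∉) → ¬z (z , ≰⇒> z∉ , z∈)))
          r : ℕ → ℕ
          r n = suc m + n
      in ¬isolated (m , (λ n → proj₁ (gap (r n))) , r ,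
           (λ n → proj₁ (proj₂ (gap (r n)))) , +-monoʳ-< (suc m) ,
           s≤s (m≤m+n m 0) , λ n → proj₂ (proj₂ (gap (r n))))

    unbounded⇒far : ∀ x₀ → ¬ Bounded X Y → Far x₀ Y
    unbounded⇒far x₀ ¬bounded n = dne λ ¬y →
      ¬bounded (x₀ , n , λ y∈Y → ≮⇒≥ λ n<d → ¬y ((_ , y∈Y) , n<d))

  -- The satellite embedding of `W₂`.

  module Satellites (x₀ : Carrier) {Y : Pred Carrier p}
                    (annuli : FilledAnnuli Y) (far : Far x₀ Y) where

    -- Bounds the distance from any centre to its `j`-th satellite. The next annulus starts at
    -- `M j + M j`, so the next satellite is more than `M j` away from all earlier ones.
    M : ℕ → ℕ
    M zero    = 0
    M (suc j) = proj₁ (annuli (M j + M j))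

    satellite : Σ Carrier Y → ℕ → Carrier
    satellite (y , _)   zero    = y
    satellite (y , y∈Y) (suc j) = proj₁ (proj₂ (annuli (M j + M j)) y y∈Y)

    satellite-upper : ∀ s j → d (proj₁ s) (satellite s j) ≤ M j
    satellite-upper _         zero    = ≤-reflexive (≈⇒0 EqC.refl)
    satellite-upper (y , y∈Y) (suc j) =
      proj₂ (proj₂ (proj₂ (annuli (M j + M j)) y y∈Y))

    satellite-lower : ∀ s j → M j + M j < d (proj₁ s) (satellite s (suc j))
    satellite-lower (y , y∈Y) j =
      proj₁ (proj₂ (proj₂ (annuli (M j + M j)) y y∈Y))

    -- A satellite of any one centre separates the two values; `far 0` supplies the centre.
    M-increasing : ∀ j → M j < M (suc j)
    M-increasing j = ≤-<-trans (m≤m+n (M j) (M j))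
      (<-≤-trans (satellite-lower s j) (satellite-upper s (suc j)))
      where s = proj₁ (far 0)

    M-mono : ∀ {i j} → i ≤ j → M i ≤ M j
    M-mono = nondecreasing⇒monotonic (<⇒≤ ∘ M-increasing)

    y : ℕ → Σ Carrier Y
    e : ℕ → ℕ
    y zero    = proj₁ (far 0)
    -- The summands after `e n` pay for two satellite radii and for the distance `suc n` that must
    -- remain between columns.
    y (suc n) = proj₁ (far (e n + (M (suc n) + (suc n + M (suc n)))))
    e n = d x₀ (proj₁ (y n))

    e-gap : ∀ n → e n + (M (suc n) + (suc n + M (suc n))) < e (suc n)
    e-gap n = proj₂ (far (e n + (M (suc n) + (suc n + M (suc n)))))

    e-mono : ∀ {m n} → m ≤ n → e m ≤ e n
    e-mono = nondecreasing⇒monotonic λ n →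
      ≤-trans (m≤m+n (e n) _) (<⇒≤ (e-gap n))

    e-sparse : ∀ {m n} → m < n → e m + (M n + (n + M n)) < e n
    e-sparse {m} {suc n} m<n =
      ≤-<-trans (+-monoˡ-≤ _ (e-mono (s≤s⁻¹ m<n))) (e-gap n)

    g : ℕ × ℕ → Carrier
    g (n , j) = satellite (y n) j

    g-column-lower : ∀ n {i j} → i < j → j ≤ d (g (n , i)) (g (n , j))
    g-column-lower n {i} {suc j} i<j =
      ≤-<-trans (increasing⇒n≤f[n] M-increasing j) (+-cancelˡ-< (M j) _ _ (begin-strict
        M j + M j                              <⟨ satellite-lower (y n) j ⟩
        d yₙ v                                 ≤⟨ triangle yₙ u v ⟩
        d yₙ u + d u v                         ≤⟨ +-monoˡ-≤ _ (satellite-upper (y n) i) ⟩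
        M i + d u v                            ≤⟨ +-monoˡ-≤ _ (M-mono (s≤s⁻¹ i<j)) ⟩
        M j + d u v                            ∎))
      where
      open ≤-Reasoning
      yₙ = proj₁ (y n)
      u = g (n , i)
      v = g (n , suc j)

    -- On the path from `x₀` to `yₙ` through `yₘ`, `u` and `v`, all legs but the one from `u` to `v`
    -- total at most `e m + M n + M n`. Sparsity leaves more than `n` for that leg.
    g-lower : ∀ {m n i j} → m < n → i ≤ m → j ≤ n → n < d (g (m , i)) (g (n , j))
    g-lower {m} {n} {i} {j} m<n i≤m j≤n =
      +-cancelʳ-< (M n) _ _ (+-cancelˡ-< (M n) _ _ (+-cancelˡ-< (e m) _ _ (begin-strict
        e m + (M n + (n + M n))
          <⟨ e-sparse m<n ⟩
        d x₀ yₙ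
          ≤⟨ triangle x₀ yₘ yₙ ⟩
        e m + d yₘ yₙ
          ≤⟨ +-monoʳ-≤ (e m) (triangle yₘ u yₙ) ⟩
        e m + (d yₘ u + d u yₙ)
          ≤⟨ +-monoʳ-≤ (e m) (+-monoʳ-≤ (d yₘ u) (triangle u v yₙ)) ⟩
        e m + (d yₘ u + (d u v + d v yₙ))
          ≤⟨ +-monoʳ-≤ (e m) (+-mono-≤ yu≤ (+-monoʳ-≤ (d u v) vy≤)) ⟩
        e m + (M n + (d u v + M n)) ∎)))
      where
      open ≤-Reasoning
      yₘ = proj₁ (y m)
      yₙ = proj₁ (y n)
      u = g (m , i)
      v = g (n , j)
      yu≤ : d yₘ u ≤ M n
      yu≤ = ≤-trans (satellite-upper (y m) i) (M-mono (≤-trans i≤m (<⇒≤ m<n)))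
      vy≤ : d v yₙ ≤ M n
      vy≤ = ≤-trans (≤-reflexive (d-sym v yₙ))
        (≤-trans (satellite-upper (y n) j) (M-mono j≤n))

    U : ℕ → ℕ
    U n = (e n + M n) + (e n + M n)

    U-mono : ∀ {m n} → m ≤ n → U m ≤ U n
    U-mono m≤n = +-mono-≤ eM eM
      where eM = +-mono-≤ (e-mono m≤n) (M-mono m≤n)

    -- The detour through the common centre gives a bound free of the column `n`, which can be
    -- arbitrarily large while the distance in `W₂` stays `j`.
    g-column-upper : ∀ n {i j} → i < j → d (g (n , i)) (g (n , j)) ≤ U j
    g-column-upper n {i} {j} i<j = begin
      d u v                ≤⟨ triangle u yₙ v ⟩
      d u yₙ + d yₙ v      ≡⟨ cong (_+ d yₙ v) (d-sym u yₙ) ⟩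
      d yₙ u + d yₙ v      ≤⟨ +-mono-≤ (satellite-upper (y n) i) (satellite-upper (y n) j) ⟩
      M i + M j            ≤⟨ +-monoˡ-≤ (M j) (M-mono (<⇒≤ i<j)) ⟩
      M j + M j            ≤⟨ +-mono-≤ (m≤n+m (M j) (e j)) (m≤n+m (M j) (e j)) ⟩
      U j                  ∎
      where
      open ≤-Reasoning
      yₙ = proj₁ (y n)
      u = g (n , i)
      v = g (n , j)

    g-centre : ∀ {m n i} → i ≤ m → m ≤ n → d x₀ (g (m , i)) ≤ e n + M n
    g-centre {m} {i = i} i≤m m≤n = ≤-trans (triangle x₀ (proj₁ (y m)) _)
      (+-mono-≤ (e-mono m≤n)
        (≤-trans (satellite-upper (y m) i) (M-mono (≤-trans i≤m m≤n))))

    g-upper : ∀ {m n i j} → m < n → i ≤ m → j ≤ n → d (g (m , i)) (g (n , j)) ≤ U n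
    g-upper m<n i≤m j≤n = ≤-trans (triangle _ x₀ _)
      (+-mono-≤ (≤-trans (≤-reflexive (d-sym _ x₀)) (g-centre i≤m (<⇒≤ m<n)))
                (g-centre j≤n ≤-refl))

    -- Joins expansion and the coarse upper bound, so that symmetry of the metrics halves the cases
    -- for both at once.
    Controlled : ℕ → ℕ → Set
    Controlled r δ = r ≤ δ × δ ≤ U r

    flip-controlled : ∀ u v → Controlled (ρ u v) (d (g u) (g v)) →
                      Controlled (ρ v u) (d (g v) (g u))
    flip-controlled u v =
      subst₂ Controlled (Metric.sym ω×ω u v) (d-sym (g u) (g v))

    g-column-controlled : ∀ n {i j} → i < j →
      Controlled (ρ (n , i) (n , j)) (d (g (n , i)) (g (n , j)))
    g-column-controlled n i<j rewrite ρ-sameColumn n i<j =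
      g-column-lower n i<j , g-column-upper n i<j

    g-columns-controlled : ∀ {m n i j} → m < n → i ≤ m → j ≤ n →
      Controlled (ρ (m , i) (n , j)) (d (g (m , i)) (g (n , j)))
    g-columns-controlled m<n i≤m j≤n rewrite ρ-differentColumns m<n i≤m j≤n =
      <⇒≤ (g-lower m<n i≤m j≤n) , g-upper m<n i≤m j≤n

    g-controlled : ∀ m i n j → i ≤ m → j ≤ n →
      Controlled (ρ (m , i) (n , j)) (d (g (m , i)) (g (n , j)))
    g-controlled m i n j i≤m j≤n with <-cmp m n
    ... | tri< m<n _ _ = g-columns-controlled m<n i≤m j≤n
    ... | tri> _ _ n<m = flip-controlled (n , j) (m , i)
                           (g-columns-controlled n<m j≤n i≤m)
    ... | tri≈ _ refl _ with <-cmp i j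
    ...   | tri< i<j _ _  = g-column-controlled n i<j
    ...   | tri> _ _ j<i  = flip-controlled (n , j) (n , i)
                              (g-column-controlled n j<i)
    ...   | tri≈ _ refl _ = subst₂ Controlled
              (sym (Metric.≈⇒0 ω×ω {n , i} refl)) (sym (≈⇒0 EqC.refl)) (z≤n , z≤n)

    W₂-embeds : HasSubspaceAsymorphicTo X W₂ p
    W₂-embeds = expandingEmbedding p W₂ (g ∘ proj₁)
      (λ {u} {v} u≡v → subst (λ w → g (proj₁ u) ≈ g w) u≡v EqC.refl)
      (λ u v → proj₁ (control u v))
      U
      (λ n u v ρ≤n → ≤-trans (proj₂ (control u v)) (U-mono ρ≤n))
      where
      control : ∀ (u v : Metric.Carrier W₂) →
        Controlled (ρ (proj₁ u) (proj₁ v)) (d (g (proj₁ u)) (g (proj₁ v)))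
      control u v = g-controlled _ _ _ _ (W₂-below u) (W₂-below v)

-- The given point excludes the empty space, whose empty subset counts as unbounded but admits no
-- sequence of centres, although no copy of `W₂` exists there.
theorem3 : ∀ {a ℓ p} → ExcludedMiddle (a ⊔ ℓ ⊔ p) →
    (X : Metric a ℓ) → Metric.Carrier X →
    AsymptoticallyScattered X p ⇔ (¬ HasSubspaceAsymorphicTo X W₂ p)
theorem3 {a} {ℓ} {p} em X x₀ = mk⇔ (scattered⇒¬asymorphic X)
  λ ¬W₂ Y _ ¬bounded → dne λ ¬isolated → ¬W₂ (Satellites.W₂-embeds X x₀
    (¬isolated⇒filledAnnuli X dne ¬isolated) (unbounded⇒far X dne x₀ ¬bounded))
  where
  dne : DoubleNegationElimination (a ⊔ p)
  dne = dne-lower {q = ℓ} (em⇒dne em)
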